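{- Let $n\ge1$. Among the elements of $R$ whose binary representation has length $2n+5$, exactly one has binary representation beginning with $1000$, namely $[1000(10)^n0]_2$; moreover $[1000(10)^n0]_2$ is the smallest element of $R$ whose binary representation has length $2n+5$.
   Context: Stern's sequence $(a(n))_{n\ge0}$: $a(0)=0$, $a(1)=1$, $a(2n)=a(n)$, $a(2n+1)=a(n)+a(n+1)$; $s(n)=a(n+1)$. $R$ is the set of record-setters of $s$, i.e. indices $v\ge0$ with $s(i)<s(v)$ for all $i<v$. Binary representations have no leading zeros. For a binary string $x$, $[x]_2$ is the integer it represents in base 2; $x^i$ denotes $i$-fold concatenation. -}

module Defs where

open import Data.Digit using (Bit; 0b; 1b; fromDigits)
open import Data.List.Base using (List; []; _∷_; _++_; concat; length; replicate; reverse)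
open import Data.List.Relation.Binary.Prefix.Heterogeneous using (Prefix)
open import Data.Nat.Base using (ℕ; zero; suc; _+_; _*_; _≤_; _<_; ⌊_/2⌋; ⌈_/2⌉; parity)
open import Data.Nat.Properties using (≤-refl; ≤-trans; ≤-pred; +-suc; +-comm; ⌊n/2⌋<n; ⌈n/2⌉<n)
open import Data.Parity.Base using (Parity; 0ℙ; 1ℙ)
open import Data.Product.Base using (_×_; ∃-syntax)
open import Relation.Binary.PropositionalEquality using (_≡_; refl; trans; cong; cong₂)
open import Relation.Unary using (Pred)
open import Level using (0ℓ)

-- The first argument is fuel: any amount ≥ n gives the same value at n, and
-- the defining recurrences of a are a-0, a-1, a-even and a-odd below.
mutual
  a-fuel : ℕ → ℕ → ℕ
  a-fuel _       0               = 0
  a-fuel _       1               = 1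
  a-fuel zero    (suc (suc _))   = 0
  a-fuel (suc k) n@(suc (suc _)) = a-step k n (parity n)

  a-step : ℕ → ℕ → Parity → ℕ
  a-step k n 0ℙ = a-fuel k ⌊ n /2⌋
  a-step k n 1ℙ = a-fuel k ⌊ n /2⌋ + a-fuel k ⌈ n /2⌉

a : ℕ → ℕ
a n = a-fuel n n

private
  half< : ∀ {k} n → suc (suc n) ≤ suc k → ⌊ suc (suc n) /2⌋ ≤ k
  half< n le = ≤-pred (≤-trans (⌊n/2⌋<n (suc n)) le)

  half<′ : ∀ {k} n → suc (suc n) ≤ suc k → ⌈ suc (suc n) /2⌉ ≤ k
  half<′ n le = ≤-pred (≤-trans (⌈n/2⌉<n n) le)

  mutual
    fuel-irr : ∀ k l n → n ≤ k → n ≤ l → a-fuel k n ≡ a-fuel l n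
    fuel-irr k l 0 _ _ = refl
    fuel-irr k l 1 _ _ = refl
    fuel-irr (suc k) (suc l) (suc (suc n)) p q = step-irr k l n (parity n) p q

    step-irr : ∀ k l n b → suc (suc n) ≤ suc k → suc (suc n) ≤ suc l →
               a-step k (suc (suc n)) b ≡ a-step l (suc (suc n)) b
    step-irr k l n 0ℙ p q = fuel-irr k l _ (half< n p) (half< n q)
    step-irr k l n 1ℙ p q = cong₂ _+_ (fuel-irr k l _ (half< n p) (half< n q))
                                      (fuel-irr k l _ (half<′ n p) (half<′ n q))

  a-unfold-even : ∀ n → parity n ≡ 0ℙ → a n ≡ a ⌊ n /2⌋
  a-unfold-even 0 _ = refl
  a-unfold-even (suc (suc n)) e =
    trans (cong (a-step (suc n) (suc (suc n))) e)
          (fuel-irr (suc n) _ _ (half< n ≤-refl) ≤-refl)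

  a-unfold-odd : ∀ n → parity n ≡ 1ℙ → a n ≡ a ⌊ n /2⌋ + a ⌈ n /2⌉
  a-unfold-odd 1 _ = refl
  a-unfold-odd (suc (suc n)) e =
    trans (cong (a-step (suc n) (suc (suc n))) e)
          (cong₂ _+_ (fuel-irr (suc n) _ _ (half< n ≤-refl) ≤-refl)
                     (fuel-irr (suc n) _ _ (half<′ n ≤-refl) ≤-refl))

  2*suc : ∀ n → 2 * suc n ≡ suc (suc (2 * n))
  2*suc n = cong suc (+-suc n (n + 0))

  parity-2* : ∀ n → parity (2 * n) ≡ 0ℙ
  parity-2* zero    = refl
  parity-2* (suc n) = trans (cong parity (2*suc n)) (parity-2* n)

  parity-1+2* : ∀ n → parity (suc (2 * n)) ≡ 1ℙ
  parity-1+2* zero    = refl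
  parity-1+2* (suc n) = trans (cong (λ m → parity (suc m)) (2*suc n)) (parity-1+2* n)

  ⌊2*/2⌋ : ∀ n → ⌊ 2 * n /2⌋ ≡ n
  ⌊2*/2⌋ zero    = refl
  ⌊2*/2⌋ (suc n) = trans (cong ⌊_/2⌋ (2*suc n)) (cong suc (⌊2*/2⌋ n))

  ⌊1+2*/2⌋ : ∀ n → ⌊ suc (2 * n) /2⌋ ≡ n
  ⌊1+2*/2⌋ zero    = refl
  ⌊1+2*/2⌋ (suc n) = trans (cong (λ m → ⌊ suc m /2⌋) (2*suc n)) (cong suc (⌊1+2*/2⌋ n))

a-0 : a 0 ≡ 0
a-0 = refl

a-1 : a 1 ≡ 1
a-1 = refl

a-even : ∀ n → a (2 * n) ≡ a n
a-even n = trans (a-unfold-even (2 * n) (parity-2* n)) (cong a (⌊2*/2⌋ n))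

a-odd : ∀ n → a (2 * n + 1) ≡ a n + a (n + 1)
a-odd n = trans (cong a (+-comm (2 * n) 1))
  (trans (a-unfold-odd (suc (2 * n)) (parity-1+2* n))
         (cong₂ _+_ (cong a (⌊1+2*/2⌋ n))
                    (cong a (trans (cong suc (⌊2*/2⌋ n)) (+-comm 1 n)))))

s : ℕ → ℕ
s n = a (n + 1)

R : Pred ℕ 0ℓ
R v = ∀ i → i < v → s i < s v

-- Binary strings are written most significant bit first, whereas fromDigits
-- expects the least significant digit first.
[_]₂ : List Bit → ℕ
[ x ]₂ = fromDigits (reverse x)

_^^_ : List Bit → ℕ → List Bit
x ^^ i = concat (replicate i x)

-- 0 is represented by the empty string.
data NoLeadingZeros : List Bit → Set where
  empty   : NoLeadingZeros []
  leading : ∀ x → NoLeadingZeros (1b ∷ x)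

_IsBinaryRepOf_ : List Bit → ℕ → Set
x IsBinaryRepOf v = NoLeadingZeros x × [ x ]₂ ≡ v

BinaryLength : ℕ → Pred ℕ 0ℓ
BinaryLength ℓ v = ∃[ x ] (x IsBinaryRepOf v × length x ≡ ℓ)

BinaryBeginsWith : List Bit → Pred ℕ 0ℓ
BinaryBeginsWith p v = ∃[ x ] (x IsBinaryRepOf v × Prefix _≡_ p x)

IsSmallest : Pred ℕ 0ℓ → Pred ℕ 0ℓ
IsSmallest P v = P v × (∀ m → P m → v ≤ m)

1000b : List Bit
1000b = 1b ∷ 0b ∷ 0b ∷ 0b ∷ []

word : ℕ → List Bit
word n = 1000b ++ (1b ∷ 0b ∷ []) ^^ n ++ 0b ∷ []

{-# OPTIONS --safe #-}
-- Reading the bits of a number from the left, the pair (a m , a (m + 1)) = (p , q)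
-- becomes (p , p + q) on the bit 0 and (p + q , q) on the bit 1, so a (m 2ᵏ + r) is
-- a function of (p , q) and the k bits of r.  For p ≤ q its maximum over r ≤ 2ᵏ is
-- q F(k+1) + p F(k).  With m = 0 this bounds s below 2^(2n+4) by F(2n+5), a value
-- that is attained there; with m = 8 (where p = 1, q = 4) and k = 2n + 1 the maximum
-- is attained at the last bits of [1000(10)ⁿ0]₂ + 1, and it exceeds F(2n+5).  Any
-- smaller r deviates from (10)ⁿ1 by a 0 in place of some 1, and that costs
-- enough to bring the value down to at most F(2n+5).
module Submission where

open import Defs
open import Data.Digit using (Bit; 0b; 1b; Expansion; fromDigits)
open import Data.Fin.Base using (toℕ)
open import Data.Fin.Properties using (toℕ≤pred[n])
open import Data.List.Base using (List; []; _∷_; _++_; _∷ʳ_; length; reverse)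
open import Data.List.Properties using (unfold-reverse; length-reverse)
open import Data.List.Relation.Binary.Prefix.Heterogeneous using ([]; _∷_)
open import Data.Nat.Base using (ℕ; zero; suc; pred; _+_; _*_; _^_; _≤_; _<_; z≤n; s≤s; z<s; >-nonZero)
open import Data.Nat.Properties
open import Data.Nat.Tactic.RingSolver using (solve-∀)
open import Data.Product.Base using (_×_; _,_)
open import Data.Sum.Base using (inj₁; inj₂)
open import Relation.Binary.PropositionalEquality using (_≡_; refl; sym; trans; cong; cong₂; subst; subst₂)
open import Relation.Unary using (_∩_)

open ≤-Reasoning

-- Fibonacci numbers

fib : ℕ → ℕ
fib 0             = 0
fib 1             = 1
fib (suc (suc n)) = fib (suc n) + fib n

fib-even≤fib-odd : ∀ n → fib (n * 2) ≤ fib (1 + n * 2)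
fib-even≤fib-odd zero    = z≤n
fib-even≤fib-odd (suc n) = m≤m+n _ _

-- The ratio 2/3 is what `a-1000-below-ρ` requires: there 11 F(2n+1) + 11 F(2n) must not exceed
-- F(2n+7) = 13 F(2n+1) + 8 F(2n).
3*fib-even≤2*fib-odd : ∀ n → 3 * fib (n * 2) ≤ 2 * fib (1 + n * 2)
3*fib-even≤2*fib-odd zero    = z≤n
3*fib-even≤2*fib-odd (suc n) = begin
  3 * (o + e)               ≡⟨ lhs o e ⟩
  3 * o + 2 * e + e         ≤⟨ +-monoʳ-≤ (3 * o + 2 * e) (fib-even≤fib-odd n) ⟩
  3 * o + 2 * e + o         ≡⟨ rhs o e ⟩
  2 * (o + e + o)           ∎
  where
  o = fib (1 + n * 2)
  e = fib (n * 2)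
  lhs : ∀ o e → 3 * (o + e) ≡ 3 * o + 2 * e + e
  lhs = solve-∀
  rhs : ∀ o e → 3 * o + 2 * e + o ≡ 2 * (o + e + o)
  rhs = solve-∀

fib>0 : ∀ n → 0 < fib (suc n)
fib>0 zero    = z<s
fib>0 (suc n) = ≤-trans (fib>0 n) (m≤m+n _ _)

-- Stern's sequence

a-1+2* : ∀ m → a (suc (2 * m)) ≡ a m + a (suc m)
a-1+2* m = subst₂ (λ i j → a i ≡ a m + a j) (+-comm (2 * m) 1) (+-comm m 1) (a-odd m)

a-2+2* : ∀ m → a (suc (suc (2 * m))) ≡ a (suc m)
a-2+2* m = trans (cong a (lemma m)) (a-even (suc m))
  where
  lemma : ∀ m → suc (suc (2 * m)) ≡ 2 * suc m
  lemma = solve-∀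

-- Reading the two bits 10 sends the pair (p , q) to (p + q , p + 2q); this is the first coordinate,
-- `a-3+4*` the second.
a-2+4* : ∀ m → a (2 * suc (2 * m)) ≡ a m + a (suc m)
a-2+4* m = trans (a-even (suc (2 * m))) (a-1+2* m)

a-3+4* : ∀ m → a (suc (2 * suc (2 * m))) ≡ a m + a (suc m) + a (suc m)
a-3+4* m = trans (a-1+2* (suc (2 * m))) (cong₂ _+_ (a-1+2* m) (a-2+2* m))

-- With `x` a power of 2, these three identities move the leading bits 0, 1 and 10 of the remainder
-- into the prefix `m`.
shift-0 : ∀ m x r → m * (2 * x) + r ≡ 2 * m * x + r
shift-0 = solve-∀

shift-1 : ∀ m x r → m * (2 * x) + (x + r) ≡ suc (2 * m) * x + r
shift-1 = solve-∀

shift-10 : ∀ m x r → m * (2 * (2 * x)) + (2 * x + r) ≡ 2 * suc (2 * m) * x + r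
shift-10 = solve-∀

-- The hypotheses are symmetric in the pair, so either bit replaces (P , Q) by (Q , Q + P), and k
-- bits produce Fibonacci coefficients. The endpoint r = 2ᵏ is included because `s` evaluates `a`
-- one place further on.
a-block≤ : ∀ k m r {P Q} → r ≤ 2 ^ k → a m ≤ Q → a (suc m) ≤ Q → a m + a (suc m) ≤ Q + P →
           a (m * 2 ^ k + r) ≤ Q * fib (suc k) + P * fib k
a-block≤ zero m zero {P} {Q} _ p≤Q _ _ = begin
  a (m * 1 + 0)  ≡⟨ cong a (eq m) ⟩
  a m            ≤⟨ p≤Q ⟩
  Q              ≡⟨ eq′ Q P ⟩
  Q * 1 + P * 0  ∎
  where
  eq : ∀ m → m * 1 + 0 ≡ m
  eq = solve-∀
  eq′ : ∀ Q P → Q ≡ Q * 1 + P * 0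
  eq′ = solve-∀
a-block≤ zero m (suc zero) {P} {Q} _ _ q≤Q _ = begin
  a (m * 1 + 1)  ≡⟨ cong a (eq m) ⟩
  a (suc m)      ≤⟨ q≤Q ⟩
  Q              ≡⟨ eq′ Q P ⟩
  Q * 1 + P * 0  ∎
  where
  eq : ∀ m → m * 1 + 1 ≡ suc m
  eq = solve-∀
  eq′ : ∀ Q P → Q ≡ Q * 1 + P * 0
  eq′ = solve-∀
a-block≤ zero m (suc (suc r)) (s≤s ()) _ _ _
a-block≤ (suc k) m r {P} {Q} r≤ p≤Q q≤Q p+q≤ with ≤-total r (2 ^ k)
... | inj₁ r≤2^k = begin
  a (m * 2 ^ suc k + r)                 ≡⟨ cong a (shift-0 m (2 ^ k) r) ⟩
  a (2 * m * 2 ^ k + r)                 ≤⟨ a-block≤ k (2 * m) r {Q} {Q + P} r≤2^k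
                                             (≤-trans (≤-reflexive (a-even m)) (≤-trans p≤Q (m≤m+n Q P)))
                                             (≤-trans (≤-reflexive (a-1+2* m)) p+q≤) sum≤ ⟩
  (Q + P) * fib (suc k) + Q * fib k     ≡⟨ eq Q P (fib (suc k)) (fib k) ⟩
  Q * fib (suc (suc k)) + P * fib (suc k) ∎
  where
  eq : ∀ Q P x y → (Q + P) * x + Q * y ≡ Q * (x + y) + P * x
  eq = solve-∀
  sum≤ : a (2 * m) + a (suc (2 * m)) ≤ Q + P + Q
  sum≤ = begin
    a (2 * m) + a (suc (2 * m))  ≡⟨ cong₂ _+_ (a-even m) (a-1+2* m) ⟩
    a m + (a m + a (suc m))      ≤⟨ +-mono-≤ p≤Q p+q≤ ⟩
    Q + (Q + P)                  ≡⟨ +-comm Q (Q + P) ⟩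
    Q + P + Q                    ∎
... | inj₂ 2^k≤r with m≤n⇒∃[o]m+o≡n 2^k≤r
... | r′ , refl = begin
  a (m * 2 ^ suc k + (2 ^ k + r′))      ≡⟨ cong a (shift-1 m (2 ^ k) r′) ⟩
  a (suc (2 * m) * 2 ^ k + r′)          ≤⟨ a-block≤ k (suc (2 * m)) r′ {Q} {Q + P} r′≤
                                             (≤-trans (≤-reflexive (a-1+2* m)) p+q≤)
                                             (≤-trans (≤-reflexive (a-2+2* m)) (≤-trans q≤Q (m≤m+n Q P))) sum≤ ⟩
  (Q + P) * fib (suc k) + Q * fib k     ≡⟨ eq Q P (fib (suc k)) (fib k) ⟩
  Q * fib (suc (suc k)) + P * fib (suc k) ∎
  where
  eq : ∀ Q P x y → (Q + P) * x + Q * y ≡ Q * (x + y) + P * x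
  eq = solve-∀
  r′≤ : r′ ≤ 2 ^ k
  r′≤ = subst (r′ ≤_) (+-identityʳ (2 ^ k)) (+-cancelˡ-≤ (2 ^ k) _ _ r≤)
  sum≤ : a (suc (2 * m)) + a (suc (suc (2 * m))) ≤ Q + P + Q
  sum≤ = begin
    a (suc (2 * m)) + a (suc (suc (2 * m)))  ≡⟨ cong₂ _+_ (a-1+2* m) (a-2+2* m) ⟩
    a m + a (suc m) + a (suc m)              ≤⟨ +-mono-≤ p+q≤ q≤Q ⟩
    Q + P + Q                                ∎

-- ρ n = [(10)ⁿ1]₂
ρ : ℕ → ℕ
ρ zero    = 1
ρ (suc n) = 2 ^ (2 + n * 2) + ρ n

ρ≤2^ : ∀ n → ρ n ≤ 2 ^ (1 + n * 2)
ρ≤2^ zero    = s≤s z≤n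
ρ≤2^ (suc n) = begin
  x + ρ n          ≤⟨ +-monoʳ-≤ x (ρ≤2^ n) ⟩
  x + 2 ^ (1 + n * 2) ≤⟨ +-monoʳ-≤ x (^-monoʳ-≤ 2 (n≤1+n (1 + n * 2))) ⟩
  x + x            ≡⟨ cong (x +_) (sym (+-identityʳ x)) ⟩
  2 * x            ∎
  where x = 2 ^ (2 + n * 2)

-- Induction on the leading 10. The value equals the bound of `a-block≤` for P = a m and Q = a (suc
-- m), so the pattern (10)ⁿ1 attains the maximum whenever a m ≤ a (suc m).
a-ρ : ∀ n m → a (m * 2 ^ (1 + n * 2) + ρ n) ≡ a m * fib (1 + n * 2) + a (suc m) * fib (2 + n * 2)
a-ρ zero m = begin-equality
  a (m * 2 + 1)            ≡⟨ cong a (eq m) ⟩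
  a (suc (2 * m))          ≡⟨ a-1+2* m ⟩
  a m + a (suc m)          ≡⟨ cong₂ _+_ (*-identityʳ (a m)) (*-identityʳ (a (suc m))) ⟨
  a m * 1 + a (suc m) * 1  ∎
  where
  eq : ∀ m → m * 2 + 1 ≡ suc (2 * m)
  eq = solve-∀
a-ρ (suc n) m = begin-equality
  a (m * 2 ^ (3 + n * 2) + ρ (suc n))                       ≡⟨ cong a (shift-10 m x (ρ n)) ⟩
  a (2 * suc (2 * m) * x + ρ n)                             ≡⟨ a-ρ n (2 * suc (2 * m)) ⟩
  a (2 * suc (2 * m)) * o + a (suc (2 * suc (2 * m))) * e   ≡⟨ cong₂ (λ y z → y * o + z * e) (a-2+4* m) (a-3+4* m) ⟩
  (p + q) * o + (p + q + q) * e                             ≡⟨ eq p q o e ⟩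
  p * (e + o) + q * (e + o + e)                             ∎
  where
  x = 2 ^ (1 + n * 2)
  o = fib (1 + n * 2)
  e = fib (2 + n * 2)
  p = a m
  q = a (suc m)
  eq : ∀ p q o e → (p + q) * o + (p + q + q) * e ≡ p * (e + o) + q * (e + o + e)
  eq = solve-∀

-- The shape (2w + u , 3w + 2u) is kept by reading 10, with (w , u) becoming
-- (2w + u , w + u), and the right-hand side below is invariant under that step.
a-below-ρ : ∀ n m r w u → r < ρ n → a m ≡ 2 * w + u → a (suc m) ≡ 3 * w + 2 * u →
            a (m * 2 ^ (1 + n * 2) + r) ≤
            w * (5 * fib (1 + n * 2) + 2 * fib (n * 2)) + u * (2 * fib (1 + n * 2) + 3 * fib (n * 2))
a-below-ρ zero m zero w u _ p≡ _ = begin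
  a (m * 2 + 0)                ≡⟨ cong a (eq m) ⟩
  a (2 * m)                    ≡⟨ a-even m ⟩
  a m                          ≡⟨ p≡ ⟩
  2 * w + u                    ≤⟨ m≤m+n (2 * w + u) (3 * w + u) ⟩
  2 * w + u + (3 * w + u)      ≡⟨ eq′ w u ⟩
  w * 5 + u * 2                ∎
  where
  eq : ∀ m → m * 2 + 0 ≡ 2 * m
  eq = solve-∀
  eq′ : ∀ w u → 2 * w + u + (3 * w + u) ≡ w * 5 + u * 2
  eq′ = solve-∀
a-below-ρ zero m (suc r) w u (s≤s ()) _ _
a-below-ρ (suc n) m r w u r<ρ p≡ q≡ with ≤-total r (2 ^ (2 + n * 2))
-- A 0 stands where `ρ (suc n)` has its leading 1: the pair becomes (p , p + q), and the general
-- bound on the remaining bits misses the target by exactly u F(2n).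
... | inj₁ r≤x = begin
  a (m * (2 * x) + r)                              ≡⟨ cong a (shift-0 m x r) ⟩
  a (2 * m * x + r)                                ≤⟨ a-block≤ (2 + n * 2) (2 * m) r {2 * w + u} {5 * w + 3 * u} r≤x
                                                        (≤-trans (≤-reflexive p′≡) (≤-trans (m≤m+n _ (3 * w + 2 * u)) (≤-reflexive (eq₁ w u))))
                                                        (≤-reflexive q′≡)
                                                        (≤-reflexive (trans (+-comm (a (2 * m)) _) (cong₂ _+_ q′≡ p′≡))) ⟩
  (5 * w + 3 * u) * (o + e + o) + (2 * w + u) * (o + e)
                                                   ≡⟨ eq₂ w u o e ⟩
  w * (12 * o + 7 * e) + u * (7 * o + 4 * e)       ≤⟨ +-monoʳ-≤ (w * (12 * o + 7 * e)) (*-monoʳ-≤ u (+-monoʳ-≤ (7 * o) (*-monoˡ-≤ e (n≤1+n 4)))) ⟩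
  w * (12 * o + 7 * e) + u * (7 * o + 5 * e)       ≡⟨ eq₃ w u o e ⟩
  w * (5 * (o + e + o) + 2 * (o + e)) + u * (2 * (o + e + o) + 3 * (o + e)) ∎
  where
  x = 2 ^ (2 + n * 2)
  o = fib (1 + n * 2)
  e = fib (n * 2)
  eq₁ : ∀ w u → 2 * w + u + (3 * w + 2 * u) ≡ 5 * w + 3 * u
  eq₁ = solve-∀
  p′≡ : a (2 * m) ≡ 2 * w + u
  p′≡ = trans (a-even m) p≡
  q′≡ : a (suc (2 * m)) ≡ 5 * w + 3 * u
  q′≡ = trans (a-1+2* m) (trans (cong₂ _+_ p≡ q≡) (eq₁ w u))
  eq₂ : ∀ w u o e → (5 * w + 3 * u) * (o + e + o) + (2 * w + u) * (o + e) ≡ w * (12 * o + 7 * e) + u * (7 * o + 4 * e)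
  eq₂ = solve-∀
  eq₃ : ∀ w u o e → w * (12 * o + 7 * e) + u * (7 * o + 5 * e) ≡
                    w * (5 * (o + e + o) + 2 * (o + e)) + u * (2 * (o + e + o) + 3 * (o + e))
  eq₃ = solve-∀
... | inj₂ x≤r with m≤n⇒∃[o]m+o≡n x≤r
-- Here r′ < ρ n ≤ 2^(1+2n), so the bit after the leading 1 is 0 and both can be read at once.
... | r′ , refl = begin
  a (m * 2 ^ (3 + n * 2) + (2 ^ (2 + n * 2) + r′))        ≡⟨ cong a (shift-10 m (2 ^ (1 + n * 2)) r′) ⟩
  a (2 * suc (2 * m) * 2 ^ (1 + n * 2) + r′)              ≤⟨ a-below-ρ n (2 * suc (2 * m)) r′ (2 * w + u) (w + u)
                                                               (+-cancelˡ-< (2 ^ (2 + n * 2)) _ _ r<ρ)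
                                                               (trans (a-2+4* m) (trans (cong₂ _+_ p≡ q≡) (eq₁ w u)))
                                                               (trans (a-3+4* m) (trans (cong₂ (λ y z → y + z + z) p≡ q≡) (eq₂ w u))) ⟩
  (2 * w + u) * (5 * o + 2 * e) + (w + u) * (2 * o + 3 * e) ≡⟨ eq₃ w u o e ⟩
  w * (5 * (o + e + o) + 2 * (o + e)) + u * (2 * (o + e + o) + 3 * (o + e)) ∎
  where
  o = fib (1 + n * 2)
  e = fib (n * 2)
  eq₁ : ∀ w u → 2 * w + u + (3 * w + 2 * u) ≡ 2 * (2 * w + u) + (w + u)
  eq₁ = solve-∀
  eq₂ : ∀ w u → 2 * w + u + (3 * w + 2 * u) + (3 * w + 2 * u) ≡ 3 * (2 * w + u) + 2 * (w + u)
  eq₂ = solve-∀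
  eq₃ : ∀ w u o e → (2 * w + u) * (5 * o + 2 * e) + (w + u) * (2 * o + 3 * e) ≡
                    w * (5 * (o + e + o) + 2 * (o + e)) + u * (2 * (o + e + o) + 3 * (o + e))
  eq₃ = solve-∀

-- Bounds after the prefix 1000

8*≡2^ : ∀ n → 8 * 2 ^ (1 + n * 2) ≡ 2 ^ (4 + n * 2)
8*≡2^ n = lemma (2 ^ (1 + n * 2))
  where
  lemma : ∀ x → 8 * x ≡ 2 * (2 * (2 * x))
  lemma = solve-∀

a-1000≤ : ∀ n r → r ≤ 2 ^ (1 + n * 2) →
          -- The constants come from (a 8 , a 9) = (1 , 4).
          a (8 * 2 ^ (1 + n * 2) + r) ≤ 4 * fib (2 + n * 2) + 1 * fib (1 + n * 2)
a-1000≤ n r r≤ = a-block≤ (1 + n * 2) 8 r {1} {4} r≤ (s≤s z≤n) ≤-refl ≤-refl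

-- The first 10 is treated separately: the shape (2w + u , 3w + 2u) would force w = -2 at (a 8 , a
-- 9) = (1 , 4). A first bit 0 leads to (a 16 , a 17) = (1 , 5), while 10 leads to (a 34 , a 35) =
-- (5 , 9), where w = 1 and u = 3.
a-1000-below-ρ : ∀ n r → r < ρ (suc n) → a (8 * 2 ^ (1 + suc n * 2) + r) ≤ fib (5 + suc n * 2)
a-1000-below-ρ n r r<ρ with ≤-total r (2 ^ (2 + n * 2))
... | inj₁ r≤x = begin
  a (8 * 2 ^ (1 + suc n * 2) + r)            ≡⟨ cong a (shift-0 8 (2 ^ (2 + n * 2)) r) ⟩
  a (16 * 2 ^ (2 + n * 2) + r)               ≤⟨ a-block≤ (2 + n * 2) 16 r {1} {5} r≤x (s≤s z≤n) ≤-refl ≤-refl ⟩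
  5 * f₃ + 1 * f₂                            ≤⟨ m≤m+n _ (2 * f₂) ⟩
  5 * f₃ + 1 * f₂ + 2 * f₂                   ≡⟨ eq f₃ f₂ ⟩
  fib (5 + suc n * 2)                        ∎
  where
  f₃ = fib (3 + n * 2)
  f₂ = fib (2 + n * 2)
  eq : ∀ x y → 5 * x + 1 * y + 2 * y ≡ x + y + x + (x + y) + (x + y + x)
  eq = solve-∀
... | inj₂ x≤r with m≤n⇒∃[o]m+o≡n x≤r
... | r′ , refl = begin
  a (8 * 2 ^ (3 + n * 2) + (2 ^ (2 + n * 2) + r′)) ≡⟨ cong a (shift-10 8 (2 ^ (1 + n * 2)) r′) ⟩
  a (34 * 2 ^ (1 + n * 2) + r′)              ≤⟨ a-below-ρ n 34 r′ 1 3 (+-cancelˡ-< (2 ^ (2 + n * 2)) _ _ r<ρ) refl refl ⟩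
  1 * (5 * o + 2 * e) + 3 * (2 * o + 3 * e)  ≡⟨ eq₁ o e ⟩
  11 * o + 8 * e + 3 * e                     ≤⟨ +-monoʳ-≤ (11 * o + 8 * e) (3*fib-even≤2*fib-odd n) ⟩
  11 * o + 8 * e + 2 * o                     ≡⟨ eq₂ o e ⟩
  5 * (o + e + o) + 3 * (o + e)              ≡⟨ eq₃ (o + e + o) (o + e) ⟩
  fib (5 + suc n * 2)                        ∎
  where
  o = fib (1 + n * 2)
  e = fib (n * 2)
  eq₁ : ∀ o e → 1 * (5 * o + 2 * e) + 3 * (2 * o + 3 * e) ≡ 11 * o + 8 * e + 3 * e
  eq₁ = solve-∀
  eq₂ : ∀ o e → 11 * o + 8 * e + 2 * o ≡ 5 * (o + e + o) + 3 * (o + e)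
  eq₂ = solve-∀
  eq₃ : ∀ x y → 5 * x + 3 * y ≡ x + y + x + (x + y) + (x + y + x)
  eq₃ = solve-∀

-- Binary representations

fromDigits-∷ʳ : ∀ (ds : Expansion 2) d → fromDigits (ds ∷ʳ d) ≡ toℕ d * 2 ^ length ds + fromDigits ds
fromDigits-∷ʳ []       d = eq (toℕ d)
  where
  eq : ∀ x → x + 0 ≡ x * 1 + 0
  eq = solve-∀
fromDigits-∷ʳ (c ∷ ds) d = begin-equality
  toℕ c + fromDigits (ds ∷ʳ d) * 2          ≡⟨ cong (λ y → toℕ c + y * 2) (fromDigits-∷ʳ ds d) ⟩
  toℕ c + (toℕ d * x + fromDigits ds) * 2   ≡⟨ eq (toℕ c) (toℕ d) x (fromDigits ds) ⟩
  toℕ d * (2 * x) + (toℕ c + fromDigits ds * 2) ∎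
  where
  x = 2 ^ length ds
  eq : ∀ c d x y → c + (d * x + y) * 2 ≡ d * (2 * x) + (c + y * 2)
  eq = solve-∀

[∷]₂ : ∀ b x → [ b ∷ x ]₂ ≡ toℕ b * 2 ^ length x + [ x ]₂
[∷]₂ b x = begin-equality
  fromDigits (reverse (b ∷ x))                ≡⟨ cong fromDigits (unfold-reverse b x) ⟩
  fromDigits (reverse x ∷ʳ b)                 ≡⟨ fromDigits-∷ʳ (reverse x) b ⟩
  toℕ b * 2 ^ length (reverse x) + [ x ]₂     ≡⟨ cong (λ ℓ → toℕ b * 2 ^ ℓ + [ x ]₂) (length-reverse x) ⟩
  toℕ b * 2 ^ length x + [ x ]₂               ∎

[1000∷]₂ : ∀ x → [ 1000b ++ x ]₂ ≡ 8 * 2 ^ length x + [ x ]₂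
[1000∷]₂ x = begin-equality
  [ 1000b ++ x ]₂                                     ≡⟨ [∷]₂ 1b (0b ∷ 0b ∷ 0b ∷ x) ⟩
  1 * 2 ^ (3 + length x) + [ 0b ∷ 0b ∷ 0b ∷ x ]₂      ≡⟨ cong (1 * 2 ^ (3 + length x) +_)
                                                          (trans ([∷]₂ 0b (0b ∷ 0b ∷ x)) (trans ([∷]₂ 0b (0b ∷ x)) ([∷]₂ 0b x))) ⟩
  1 * 2 ^ (3 + length x) + [ x ]₂                     ≡⟨ cong (_+ [ x ]₂) (eq (2 ^ length x)) ⟩
  8 * 2 ^ length x + [ x ]₂                           ∎
  where
  eq : ∀ y → 1 * (2 * (2 * (2 * y))) ≡ 8 * y
  eq = solve-∀

[]₂<2^length : ∀ x → [ x ]₂ < 2 ^ length x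
[]₂<2^length []      = z<s
[]₂<2^length (b ∷ x) = begin-strict
  [ b ∷ x ]₂                      ≡⟨ [∷]₂ b x ⟩
  toℕ b * 2 ^ length x + [ x ]₂   <⟨ +-mono-≤-< (*-monoˡ-≤ (2 ^ length x) (toℕ≤pred[n] b)) ([]₂<2^length x) ⟩
  1 * 2 ^ length x + 2 ^ length x ≡⟨ eq (2 ^ length x) ⟩
  2 * 2 ^ length x                ∎
  where
  eq : ∀ y → 1 * y + y ≡ 2 * y
  eq = solve-∀

2^≤[1∷]₂ : ∀ x → 2 ^ length x ≤ [ 1b ∷ x ]₂
2^≤[1∷]₂ x = begin
  2 ^ length x                ≡⟨ *-identityˡ _ ⟨
  1 * 2 ^ length x            ≤⟨ m≤m+n _ [ x ]₂ ⟩
  1 * 2 ^ length x + [ x ]₂   ≡⟨ [∷]₂ 1b x ⟨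
  [ 1b ∷ x ]₂                 ∎

BinaryLength⇒2^≤ : ∀ {ℓ v} → BinaryLength (suc ℓ) v → 2 ^ ℓ ≤ v
BinaryLength⇒2^≤ (_ , (leading x , refl) , refl) = 2^≤[1∷]₂ x

BinaryLength⇒<2^ : ∀ {ℓ v} → BinaryLength ℓ v → v < 2 ^ ℓ
BinaryLength⇒<2^ (x , (_ , refl) , refl) = []₂<2^length x

BinaryLength-≤ : ∀ {k ℓ v} → BinaryLength (suc k) v → BinaryLength ℓ v → suc k ≤ ℓ
BinaryLength-≤ {k} {ℓ} k-bits ℓ-bits = ≮⇒≥ λ { (s≤s ℓ≤k) →
  <⇒≱ (BinaryLength⇒<2^ ℓ-bits) (≤-trans (^-monoʳ-≤ 2 ℓ≤k) (BinaryLength⇒2^≤ k-bits)) }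

-- The intervals from 2ᵏ to 2ᵏ⁺¹ are disjoint. `BinaryLength` and `BinaryBeginsWith` each supply a
-- string of their own; this lemma carries the length of one over to the other.
BinaryLength-unique : ∀ {k ℓ v} → BinaryLength (suc k) v → BinaryLength (suc ℓ) v → k ≡ ℓ
BinaryLength-unique p q = ≤-antisym (≤-pred (BinaryLength-≤ p q)) (≤-pred (BinaryLength-≤ q p))

suffix : ℕ → List Bit
suffix n = (1b ∷ 0b ∷ []) ^^ n ++ 0b ∷ []

length-suffix : ∀ n → length (suffix n) ≡ 1 + n * 2
length-suffix zero    = refl
length-suffix (suc n) = cong (2 +_) (length-suffix n)

-- Adding 1 turns the final 0 into 1 without a carry. The addition is the index shift in s v = a (v
-- + 1).
[suffix]₂ : ∀ n → [ suffix n ]₂ + 1 ≡ ρ n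
[suffix]₂ zero    = refl
[suffix]₂ (suc n) = begin-equality
  [ suffix (suc n) ]₂ + 1                        ≡⟨ cong (_+ 1) (trans ([∷]₂ 1b (0b ∷ y)) (cong (1 * 2 ^ suc (length y) +_) ([∷]₂ 0b y))) ⟩
  1 * 2 ^ suc (length y) + [ y ]₂ + 1            ≡⟨ cong (λ ℓ → 1 * 2 ^ suc ℓ + [ y ]₂ + 1) (length-suffix n) ⟩
  1 * 2 ^ (2 + n * 2) + [ y ]₂ + 1               ≡⟨ +-assoc (1 * 2 ^ (2 + n * 2)) [ y ]₂ 1 ⟩
  1 * 2 ^ (2 + n * 2) + ([ y ]₂ + 1)             ≡⟨ cong₂ _+_ (*-identityˡ (2 ^ (2 + n * 2))) ([suffix]₂ n) ⟩
  ρ (suc n)                                      ∎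
  where y = suffix n

[word]₂ : ∀ n → [ word n ]₂ + 1 ≡ 8 * 2 ^ (1 + n * 2) + ρ n
[word]₂ n = begin-equality
  [ word n ]₂ + 1                                       ≡⟨ cong (_+ 1) ([1000∷]₂ (suffix n)) ⟩
  8 * 2 ^ length (suffix n) + [ suffix n ]₂ + 1         ≡⟨ +-assoc (8 * 2 ^ length (suffix n)) _ 1 ⟩
  8 * 2 ^ length (suffix n) + ([ suffix n ]₂ + 1)       ≡⟨ cong₂ (λ ℓ y → 8 * 2 ^ ℓ + y) (length-suffix n) ([suffix]₂ n) ⟩
  8 * 2 ^ (1 + n * 2) + ρ n                             ∎

-- Record-setters of length 2n + 5

s-word : ∀ n → s [ word n ]₂ ≡ 4 * fib (2 + n * 2) + 1 * fib (1 + n * 2)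
s-word n = begin-equality
  a ([ word n ]₂ + 1)                          ≡⟨ cong a ([word]₂ n) ⟩
  a (8 * 2 ^ (1 + n * 2) + ρ n)                ≡⟨ a-ρ n 8 ⟩
  1 * fib (1 + n * 2) + 4 * fib (2 + n * 2)    ≡⟨ +-comm (1 * fib (1 + n * 2)) _ ⟩
  4 * fib (2 + n * 2) + 1 * fib (1 + n * 2)    ∎

-- The gap is exactly F(2n+2). At `word 0` both sides would be 5, which is why the index is `suc n`.
fib<s-word : ∀ n → fib (5 + suc n * 2) < s [ word (suc n) ]₂
fib<s-word n = begin-strict
  fib (5 + suc n * 2)              ≡⟨ eq₁ (f₂ + f₁) f₂ ⟩
  3 * (f₂ + f₁ + f₂) + 2 * (f₂ + f₁)  ≡⟨ eq₂ f₂ f₁ ⟩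
  7 * f₂ + 5 * f₁ + f₂             <⟨ +-monoʳ-< (7 * f₂ + 5 * f₁) (m<n+m f₂ (fib>0 (1 + n * 2))) ⟩
  7 * f₂ + 5 * f₁ + (f₂ + f₂)      ≡⟨ eq₃ f₂ f₁ ⟩
  4 * (f₂ + f₁ + f₂) + 1 * (f₂ + f₁)  ≡⟨ s-word (suc n) ⟨
  s [ word (suc n) ]₂              ∎
  where
  f₂ = fib (2 + n * 2)
  f₁ = fib (1 + n * 2)
  eq₁ : ∀ x y → x + y + x + (x + y) + (x + y + x) ≡ 3 * (x + y) + 2 * x
  eq₁ = solve-∀
  eq₂ : ∀ x y → 3 * (x + y + x) + 2 * (x + y) ≡ 7 * x + 5 * y + x
  eq₂ = solve-∀
  eq₃ : ∀ x y → 7 * x + 5 * y + (x + x) ≡ 4 * (x + y + x) + 1 * (x + y)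
  eq₃ = solve-∀

-- Either `v` has fewer bits than the word, and `a-block≤` applies to the empty prefix with (a 0 , a
-- 1) = (0 , 1), or v + 1 is the prefix 1000 followed by a remainder smaller than `ρ (suc n)`.
s-below-word≤fib : ∀ n v → v < [ word (suc n) ]₂ → s v ≤ fib (5 + suc n * 2)
s-below-word≤fib n v v<word with ≤-total (v + 1) (8 * 2 ^ (1 + suc n * 2))
... | inj₁ v+1≤ = begin
  a (v + 1)                                              ≤⟨ a-block≤ (4 + suc n * 2) 0 (v + 1) {0} {1}
                                                              (subst (v + 1 ≤_) (8*≡2^ (suc n)) v+1≤) z≤n ≤-refl ≤-refl ⟩
  1 * fib (5 + suc n * 2) + 0 * fib (4 + suc n * 2)      ≡⟨ eq (fib (5 + suc n * 2)) (fib (4 + suc n * 2)) ⟩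
  fib (5 + suc n * 2)                                    ∎
  where
  eq : ∀ x y → 1 * x + 0 * y ≡ x
  eq = solve-∀
... | inj₂ ≤v+1 with m≤n⇒∃[o]m+o≡n ≤v+1
... | r , eq = begin
  a (v + 1)                           ≡⟨ cong a eq ⟨
  a (8 * 2 ^ (1 + suc n * 2) + r)     ≤⟨ a-1000-below-ρ n r r<ρ ⟩
  fib (5 + suc n * 2)                 ∎
  where
  r<ρ : r < ρ (suc n)
  r<ρ = +-cancelˡ-< (8 * 2 ^ (1 + suc n * 2)) _ _
    (subst₂ _<_ (sym eq) ([word]₂ (suc n)) (+-monoˡ-< 1 v<word))

-- Since (a 6 , a 7) = (2 , 3), the sequence a takes the value F(2n+5) at [110(10)ⁿ1]₂.
fib-attained : ℕ → ℕ
fib-attained n = pred (6 * 2 ^ (1 + n * 2) + ρ n)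

fib-attained+1 : ∀ n → fib-attained n + 1 ≡ 6 * 2 ^ (1 + n * 2) + ρ n
fib-attained+1 n = trans (+-comm _ 1) (suc-pred _ {{>-nonZero positive}})
  where
  positive : 0 < 6 * 2 ^ (1 + n * 2) + ρ n
  positive = ≤-trans (*-mono-≤ {1} {6} {1} (s≤s z≤n) (m^n>0 2 (1 + n * 2))) (m≤m+n _ _)

s-fib-attained : ∀ n → s (fib-attained n) ≡ fib (5 + n * 2)
s-fib-attained n = begin-equality
  a (fib-attained n + 1)                       ≡⟨ cong a (fib-attained+1 n) ⟩
  a (6 * 2 ^ (1 + n * 2) + ρ n)                ≡⟨ a-ρ n 6 ⟩
  2 * fib (1 + n * 2) + 3 * fib (2 + n * 2)    ≡⟨ eq (fib (2 + n * 2)) (fib (1 + n * 2)) ⟩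
  fib (5 + n * 2)                              ∎
  where
  eq : ∀ x y → 2 * y + 3 * x ≡ x + y + x + (x + y)
  eq = solve-∀

fib-attained< : ∀ n → fib-attained n < 2 ^ (4 + n * 2)
fib-attained< n = begin
  suc (fib-attained n)       ≡⟨ +-comm 1 _ ⟩
  fib-attained n + 1         ≡⟨ fib-attained+1 n ⟩
  6 * x + ρ n                ≤⟨ +-monoʳ-≤ (6 * x) (ρ≤2^ n) ⟩
  6 * x + x                  ≤⟨ m≤n+m _ x ⟩
  x + (6 * x + x)            ≡⟨ eq x ⟩
  8 * x                      ≡⟨ 8*≡2^ n ⟩
  2 ^ (4 + n * 2)            ∎
  where
  x = 2 ^ (1 + n * 2)
  eq : ∀ x → x + (6 * x + x) ≡ 8 * x
  eq = solve-∀

R-word : ∀ n → R [ word (suc n) ]₂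
R-word n i i<word = ≤-<-trans (s-below-word≤fib n i i<word) (fib<s-word n)

-- A record-setter of this size must strictly exceed the Fibonacci value attained at the smaller
-- index `fib-attained (suc n)`, and no index below the word does.
word-least : ∀ n v → R v → 2 ^ (4 + suc n * 2) ≤ v → [ word (suc n) ]₂ ≤ v
word-least n v v∈R 2^≤v = ≮⇒≥ λ v<word → <⇒≱
  (subst (_< s v) (s-fib-attained (suc n)) (v∈R _ (<-≤-trans (fib-attained< (suc n)) 2^≤v)))
  (s-below-word≤fib n v v<word)

s-1000≤s-word : ∀ n x → length x ≡ 1 + n * 2 → s [ 1000b ++ x ]₂ ≤ s [ word n ]₂
s-1000≤s-word n x len = begin
  a ([ 1000b ++ x ]₂ + 1)                     ≡⟨ cong (λ v → a (v + 1)) ([1000∷]₂ x) ⟩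
  a (8 * 2 ^ length x + [ x ]₂ + 1)           ≡⟨ cong a (+-assoc (8 * 2 ^ length x) [ x ]₂ 1) ⟩
  a (8 * 2 ^ length x + ([ x ]₂ + 1))         ≡⟨ cong (λ ℓ → a (8 * 2 ^ ℓ + ([ x ]₂ + 1))) len ⟩
  a (8 * 2 ^ (1 + n * 2) + ([ x ]₂ + 1))      ≤⟨ a-1000≤ n ([ x ]₂ + 1) x+1≤ ⟩
  4 * fib (2 + n * 2) + 1 * fib (1 + n * 2)   ≡⟨ s-word n ⟨
  s [ word n ]₂                               ∎
  where
  -- Equality occurs when `x` consists of ones only; the closed range in `a-1000≤` allows for it.
  x+1≤ : [ x ]₂ + 1 ≤ 2 ^ (1 + n * 2)
  x+1≤ = subst₂ _≤_ (+-comm 1 [ x ]₂) (cong (2 ^_) len) ([]₂<2^length x)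

-- Beyond the word, no index with prefix 1000 and this length can be a record, since the word
-- already attains the maximum for that prefix; below the word, `word-least` excludes it.
word-unique : ∀ n v → R v → BinaryLength (5 + suc n * 2) v → BinaryBeginsWith 1000b v → v ≡ [ word (suc n) ]₂
word-unique n v v∈R v-bits (_ , (v-rep@(_ , refl)) , refl ∷ (refl ∷ refl ∷ refl ∷ [] {bs = x})) =
  ≤-antisym (≮⇒≥ λ word<v → <⇒≱ (v∈R _ word<v) (s-1000≤s-word (suc n) x len))
            (word-least n v v∈R (BinaryLength⇒2^≤ v-bits))
  where
  len : length x ≡ 1 + suc n * 2
  -- Of the four prefix bits, one is absorbed by the `suc` in `BinaryLength-unique`, leaving 3 to
  -- cancel.
  len = +-cancelˡ-≡ 3 _ _ (BinaryLength-unique (_ , v-rep , refl) v-bits)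

word-BinaryLength : ∀ n → BinaryLength (5 + n * 2) [ word n ]₂
word-BinaryLength n = word n , (leading _ , refl) , cong (4 +_) (length-suffix n)

word-BinaryBeginsWith : ∀ n → BinaryBeginsWith 1000b [ word n ]₂
word-BinaryBeginsWith n = word n , (leading _ , refl) , refl ∷ refl ∷ refl ∷ refl ∷ []

mainTheorem16 : ∀ (n : ℕ) → 1 ≤ n →
    let S = R ∩ BinaryLength (2 * n + 5)
        T = S ∩ BinaryBeginsWith 1000b
    in (T [ word n ]₂ × (∀ m → T m → m ≡ [ word n ]₂))
       × IsSmallest S [ word n ]₂
mainTheorem16 (suc n) _ =
  (((R-word n , word-bits) , word-BinaryBeginsWith (suc n)) ,
   λ { v ((v∈R , v-bits) , v-prefix) → word-unique n v v∈R (with-length v v-bits) v-prefix }) ,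
  (R-word n , word-bits) ,
  λ { v (v∈R , v-bits) → word-least n v v∈R (BinaryLength⇒2^≤ (with-length v v-bits)) }
  where
  -- Lengths are written with `n * 2` throughout because `suc n * 2` reduces to `2 + n * 2`,
  -- matching the recursion by two bits; the stated form is converted only here.
  length≡ : 2 * suc n + 5 ≡ 5 + suc n * 2
  length≡ = trans (+-comm (2 * suc n) 5) (cong (5 +_) (*-comm 2 (suc n)))
  word-bits : BinaryLength (2 * suc n + 5) [ word (suc n) ]₂
  word-bits = subst (λ ℓ → BinaryLength ℓ [ word (suc n) ]₂) (sym length≡) (word-BinaryLength (suc n))
  with-length : ∀ v → BinaryLength (2 * suc n + 5) v → BinaryLength (5 + suc n * 2) v
  with-length v = subst (λ ℓ → BinaryLength ℓ v) length≡
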